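{- There exists an absolute constant $c>0$ such that for every positive integer $n$ there is a set $S \subset [n]^2 = \{1,\dots,n\}^2$ with $|S| \ge c\, n^{5/4}$ which is skew corner-free, i.e. $S$ contains no three points of the form $$(x,y),\ (x,y+d),\ (x+d,y')$$ with $x,y,y'$ integers and $d \neq 0$ an integer.
   Context: A triple of points of the form $(x,y),(x,y+d),(x+d,y')$ with $d\neq 0$ (and $x,y,y'$ arbitrary) is called a skew corner; a set is skew corner-free if it contains no skew corner (all three points lying in the set). -}

module Defs where

open import Algebra.Definitions.RawSemiring using () renaming (_^_ to pow)
open import Data.Integer.Base as ℤ using (ℤ; +_; 0ℤ; 1ℤ)
open import Data.List.Base using (List; length)
open import Data.List.Membership.Propositional using (_∈_)
open import Data.List.Relation.Unary.Unique.Propositional using (Unique)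
open import Data.Nat.Base using (ℕ)
open import Data.Product.Base using (_×_; _,_)
open import Data.Rational.Base as ℚ using (ℚ)
open import Relation.Binary.PropositionalEquality.Core using (_≢_)
open import Relation.Nullary.Negation.Core using (¬_)

record FiniteSet (A : Set) : Set where
  constructor finiteSet
  field
    elements : List A
    unique   : Unique elements

  card : ℕ
  card = length elements

open FiniteSet public using (card)

infix 4 _∈ˢ_

_∈ˢ_ : {A : Set} → A → FiniteSet A → Set
a ∈ˢ S = a ∈ FiniteSet.elements S

InInterval : ℕ → ℤ → Set
InInterval n x = (1ℤ ℤ.≤ x) × (x ℤ.≤ + n)

_⊆[_]² : FiniteSet (ℤ × ℤ) → ℕ → Set
S ⊆[ n ]² = ∀ x y → (x , y) ∈ˢ S → InInterval n x × InInterval n y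

SkewCornerFree : FiniteSet (ℤ × ℤ) → Set
SkewCornerFree S = ∀ (x y y′ d : ℤ) → d ≢ 0ℤ →
  ¬ ((x , y) ∈ˢ S × (x , y ℤ.+ d) ∈ˢ S × (x ℤ.+ d , y′) ∈ˢ S)

infixr 8 _^ℚ_

_^ℚ_ : ℚ → ℕ → ℚ
_^ℚ_ = pow ℚ.+-*-rawSemiring

fromℕ : ℕ → ℚ
fromℕ n = + n ℚ./ 1

-- For c ≥ 0 this says c · n^(5/4) ≤ m: both sides of that inequality are
-- non-negative, so it may be raised to the fourth power, which avoids the
-- generally irrational number n^(5/4).  A rational c loses nothing: below every
-- positive real there is a positive rational.
_·_^5/4≤_ : ℚ → ℕ → ℕ → Set
c · n ^5/4≤ m = c ^ℚ 4 ℚ.* fromℕ n ^ℚ 5 ℚ.≤ fromℕ m ^ℚ 4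

{-# OPTIONS --safe #-}

-- Read x off a vector u and y off a vector w, both with digits in {0,…,q-1}:
-- x has the digits of u below the top digit u·u, and y has the digits of w below
-- the top digit 2(u·w).  In base 2q - 1, sums of two digits do not carry.
-- A skew corner on (u,w), (u,w₂), (u′,w′) gives x + y₂ = x′ + y, hence
-- u + w₂ = w + u′ digitwise and u·u + 2(u·w₂) = u′·u′ + 2(u·w) at the top.
-- The first equation turns the second into |u - u′|² = 0, so u′ = u and d = 0:
-- a tangent of a paraboloid meets it only once.
-- For vectors of length k this puts q²ᵏ points in a square of side O(qᵏ⁺²), and
-- k = 4 suffices since 8/6 ≥ 5/4.
module Submission where

import Algebra.Properties.AbelianGroup as AbelianGroup
import Algebra.Properties.CommutativeSemiring.Exp as Exp
open import Algebra.Bundles using (CommutativeRing)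
open import Data.Fin.Base using (Fin; toℕ)
open import Data.Fin.Properties using (toℕ-injective; toℕ≤pred[n])
open import Data.Integer.Base as ℤ using (ℤ; +_; 1ℤ)
import Data.Integer.Properties as ℤ
open import Data.List.Base as List
  using (List; []; _∷_; length; cartesianProductWith; cartesianProduct; allFin)
open import Data.List.Membership.Propositional.Properties using (∈-map⁻)
open import Data.List.Properties using (length-++; length-map; length-tabulate)
open import Data.List.Relation.Unary.AllPairs using ([]; _∷_)
open import Data.List.Relation.Unary.All using ([])
open import Data.List.Relation.Unary.Unique.Propositional using (Unique)
import Data.List.Relation.Unary.Unique.Propositional.Properties as Unique
open import Data.Nat.Base
  using (ℕ; zero; suc; _+_; _*_; _^_; _≤_; _<_; z≤n; s≤s; NonZero; >-nonZero⁻¹; ∣_-_∣)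
open import Data.Nat.DivMod using (_%_; [m+kn]%n≡m%n; m<n⇒m%n≡m)
open import Data.Nat.Properties
open import Data.Nat.Tactic.RingSolver using (solve-∀)
open import Data.Product using (_×_; _,_; proj₁; proj₂; ∃-syntax; Σ-syntax)
open import Data.Rational.Base as ℚ using (ℚ; 0ℚ; 1ℚ)
import Data.Rational.Properties as ℚ
open import Data.Rational.Unnormalised.Base as ℚᵘ using (mkℚᵘ; *≡*; *≤*)
import Data.Rational.Unnormalised.Properties as ℚᵘ
open import Data.Sum.Base using (inj₁; inj₂)
open import Data.Vec.Base as Vec using (Vec; []; _∷_; zipWith; replicate)
open import Data.Vec.Properties using (∷-injective)
open import Data.Vec.Relation.Unary.All as All using (All; []; _∷_)
open import Data.Vec.Relation.Unary.All.Properties using (map⁺)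
open import Relation.Binary.PropositionalEquality
  using (_≡_; refl; sym; trans; cong; cong₂; subst; module ≡-Reasoning)
open import Defs

open AbelianGroup ℤ.+-0-abelianGroup using (identityʳ-unique)

private variable
  k : ℕ

-- Digit vectors and the tangent identity

infixl 7 _·_
infixl 6 _⊕_

_⊕_ : Vec ℕ k → Vec ℕ k → Vec ℕ k
_⊕_ = zipWith _+_

_·_ : Vec ℕ k → Vec ℕ k → ℕ
[]      · []      = 0
(a ∷ u) · (b ∷ w) = a * b + u · w

·-≤ : ∀ {p} {u w : Vec ℕ k} → All (_≤ p) u → All (_≤ p) w → u · w ≤ k * (p * p)
·-≤ []        []        = z≤n
·-≤ (a≤ ∷ u≤) (b≤ ∷ w≤) = +-mono-≤ (*-mono-≤ a≤ b≤) (·-≤ u≤ w≤)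

-- Absolute differences keep the squared Euclidean distance inside ℕ, where truncated subtraction
-- would lose it.
dist² : Vec ℕ k → Vec ℕ k → ℕ
dist² u v = zipWith ∣_-_∣ u v · zipWith ∣_-_∣ u v

dist²≡0⇒≡ : (u v : Vec ℕ k) → dist² u v ≡ 0 → u ≡ v
dist²≡0⇒≡ []      []      _  = refl
dist²≡0⇒≡ (a ∷ u) (b ∷ v) eq = cong₂ _∷_
  (∣m-n∣≡0⇒m≡n (m^n≡0⇒m≡0 ∣ a - b ∣ 2
    -- `x ^ 2` unfolds to `x * (x * 1)`, hence the inner factor 1.
    (trans (cong (∣ a - b ∣ *_) (*-identityʳ _)) (m+n≡0⇒m≡0 _ eq))))
  (dist²≡0⇒≡ u v (m+n≡0⇒n≡0 (∣ a - b ∣ * ∣ a - b ∣) eq))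

-- The hypothesis says b - c = a′ - a, so over the integers this is a² + 2a(a′ - a) + (a - a′)² =
-- a′². Splitting on the order of `a` and `a′` writes the difference as a natural number `e`.
tangent-digit : ∀ a b c a′ → a + b ≡ c + a′ →
  a * a + 2 * (a * b) + ∣ a - a′ ∣ * ∣ a - a′ ∣ ≡ a′ * a′ + 2 * (a * c)
tangent-digit a b c a′ eq with ≤-total a a′
... | inj₁ a≤a′ with e , refl ← m≤n⇒∃[o]m+o≡n a≤a′ = begin
  a * a + 2 * (a * b) + δ * δ
    ≡⟨ cong₂ (λ b δ → a * a + 2 * (a * b) + δ * δ) b≡c+e (∣m-m+n∣≡n a e) ⟩
  a * a + 2 * (a * (c + e)) + e * e  ≡⟨ ring₂ a c e ⟩
  (a + e) * (a + e) + 2 * (a * c)    ∎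
  where
  open ≡-Reasoning
  δ = ∣ a - a + e ∣
  ring₁ : ∀ a c e → c + (a + e) ≡ a + (c + e)
  ring₁ = solve-∀
  ring₂ : ∀ a c e → a * a + 2 * (a * (c + e)) + e * e ≡ (a + e) * (a + e) + 2 * (a * c)
  ring₂ = solve-∀
  b≡c+e : b ≡ c + e
  b≡c+e = +-cancelˡ-≡ a b (c + e) (trans eq (ring₁ a c e))
... | inj₂ a′≤a with e , refl ← m≤n⇒∃[o]m+o≡n a′≤a = begin
  (a′ + e) * (a′ + e) + 2 * ((a′ + e) * b) + δ * δ
    ≡⟨ cong (λ δ → (a′ + e) * (a′ + e) + 2 * ((a′ + e) * b) + δ * δ) δ≡e ⟩
  (a′ + e) * (a′ + e) + 2 * ((a′ + e) * b) + e * e  ≡⟨ ring₂ a′ b e ⟩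
  a′ * a′ + 2 * ((a′ + e) * (b + e))
    ≡⟨ cong (λ c → a′ * a′ + 2 * ((a′ + e) * c)) b+e≡c ⟩
  a′ * a′ + 2 * ((a′ + e) * c)                      ∎
  where
  open ≡-Reasoning
  δ = ∣ a′ + e - a′ ∣
  δ≡e : δ ≡ e
  δ≡e = trans (∣-∣-comm (a′ + e) a′) (∣m-m+n∣≡n a′ e)
  ring₁ : ∀ a b e → b + e + a ≡ a + e + b
  ring₁ = solve-∀
  ring₂ : ∀ a b e → (a + e) * (a + e) + 2 * ((a + e) * b) + e * e
                  ≡ a * a + 2 * ((a + e) * (b + e))
  ring₂ = solve-∀
  b+e≡c : b + e ≡ c
  b+e≡c = +-cancelʳ-≡ a′ (b + e) c (trans (ring₁ a′ b e) eq)

tangent : (u w₂ w u′ : Vec ℕ k) → u ⊕ w₂ ≡ w ⊕ u′ →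
  u · u + 2 * (u · w₂) + dist² u u′ ≡ u′ · u′ + 2 * (u · w)
tangent []      []       []      []        _  = refl
tangent (a ∷ u) (b ∷ w₂) (c ∷ w) (a′ ∷ u′) eq = begin
  (a * a + u · u) + 2 * (a * b + u · w₂) + (δ * δ + dist² u u′)
    ≡⟨ ring₁ (a * a) (u · u) (a * b) (u · w₂) (δ * δ) (dist² u u′) ⟩
  (a * a + 2 * (a * b) + δ * δ) + (u · u + 2 * (u · w₂) + dist² u u′)
    ≡⟨ cong₂ _+_ (tangent-digit a b c a′ (proj₁ (∷-injective eq)))
                 (tangent u w₂ w u′ (proj₂ (∷-injective eq))) ⟩
  (a′ * a′ + 2 * (a * c)) + (u′ · u′ + 2 * (u · w))
    ≡⟨ ring₂ (a′ * a′) (a * c) (u′ · u′) (u · w) ⟩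
  (a′ * a′ + u′ · u′) + 2 * (a * c + u · w) ∎
  where
  open ≡-Reasoning
  δ = ∣ a - a′ ∣
  ring₁ : ∀ x u y v z d → (x + u) + 2 * (y + v) + (z + d) ≡ (x + 2 * y + z) + (u + 2 * v + d)
  ring₁ = solve-∀
  ring₂ : ∀ x y u v → (x + 2 * y) + (u + 2 * v) ≡ (x + u) + 2 * (y + v)
  ring₂ = solve-∀

-- The summands of the second hypothesis stand in the order in which `encode-⊕` adds the top digits
-- of the two sides of a corner equation.
tangent-unique : (u w₂ w u′ : Vec ℕ k) → u ⊕ w₂ ≡ w ⊕ u′ →
  u · u + 2 * (u · w₂) ≡ 2 * (u · w) + u′ · u′ → u ≡ u′
tangent-unique u w₂ w u′ digits top = dist²≡0⇒≡ u u′ (+-cancelˡ-≡ (2 * (u · w) + u′ · u′) _ _ (begin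
  2 * (u · w) + u′ · u′ + dist² u u′     ≡⟨ cong (_+ dist² u u′) top ⟨
  u · u + 2 * (u · w₂) + dist² u u′      ≡⟨ tangent u w₂ w u′ digits ⟩
  u′ · u′ + 2 * (u · w)                  ≡⟨ +-comm (u′ · u′) _ ⟩
  2 * (u · w) + u′ · u′                  ≡⟨ +-identityʳ _ ⟨
  2 * (u · w) + u′ · u′ + 0              ∎))
  where open ≡-Reasoning

-- Positional notation

-- Least significant digit first. The top digit `t` may exceed `B`, which leaves room for a
-- quadratic expression in the other digits.
encode : ℕ → ℕ → Vec ℕ k → ℕ
encode B t []      = t
encode B t (a ∷ u) = a + encode B t u * B

-- Digits of any size are allowed here; the absence of carries matters only when digits are read
-- back by `encode-injective`.
encode-⊕ : ∀ B s t (u v : Vec ℕ k) → encode B s u + encode B t v ≡ encode B (s + t) (u ⊕ v)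
encode-⊕ B s t []      []      = refl
encode-⊕ B s t (a ∷ u) (b ∷ v) = trans
  (ring a b (encode B s u) (encode B t v) B)
  (cong (λ e → a + b + e * B) (encode-⊕ B s t u v))
  where
  ring : ∀ a b s t B → (a + s * B) + (b + t * B) ≡ a + b + (s + t) * B
  ring = solve-∀

encode-mono-≤ : ∀ B {p s t} {u : Vec ℕ k} → All (_≤ p) u → s ≤ t →
  encode B s u ≤ encode B t (replicate k p)
encode-mono-≤ B []        s≤t = s≤t
encode-mono-≤ B (a≤ ∷ u≤) s≤t = +-mono-≤ a≤ (*-monoˡ-≤ B (encode-mono-≤ B u≤ s≤t))

quotRem-unique : ∀ B .{{_ : NonZero B}} {r r′} s s′ → r < B → r′ < B →
  r + s * B ≡ r′ + s′ * B → r ≡ r′ × s ≡ s′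
quotRem-unique B {r} {r′} s s′ r<B r′<B eq = r≡r′ , *-cancelʳ-≡ s s′ B
  (+-cancelˡ-≡ r _ _ (trans eq (cong (_+ s′ * B) (sym r≡r′))))
  where
  open ≡-Reasoning
  r≡r′ : r ≡ r′
  r≡r′ = begin
    r                  ≡⟨ m<n⇒m%n≡m r<B ⟨
    r % B              ≡⟨ [m+kn]%n≡m%n r s B ⟨
    (r + s * B) % B    ≡⟨ cong (_% B) eq ⟩
    (r′ + s′ * B) % B  ≡⟨ [m+kn]%n≡m%n r′ s′ B ⟩
    r′ % B             ≡⟨ m<n⇒m%n≡m r′<B ⟩
    r′                 ∎

encode-injective : ∀ B .{{_ : NonZero B}} {s t} {u v : Vec ℕ k} →
  All (_< B) u → All (_< B) v → encode B s u ≡ encode B t v → s ≡ t × u ≡ v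
encode-injective B []        []        eq = eq , refl
encode-injective B {s} {t} {a ∷ u} {b ∷ v} (a< ∷ u<) (b< ∷ v<) eq
  with a≡b , eq′ ← quotRem-unique B (encode B s u) (encode B t v) a< b< eq
  with s≡t , u≡v ← encode-injective B u< v< eq′ = s≡t , cong₂ _∷_ a≡b u≡v

-- Enumeration of the box {0,…,q-1}ᵏ

length-cartesianProductWith : ∀ {A B C : Set} (f : A → B → C) xs ys →
  length (cartesianProductWith f xs ys) ≡ length xs * length ys
length-cartesianProductWith f []       ys = refl
length-cartesianProductWith f (x ∷ xs) ys = trans (length-++ (List.map (f x) ys))
  (cong₂ _+_ (length-map (f x) ys) (length-cartesianProductWith f xs ys))

box : ∀ q k → List (Vec (Fin q) k)
box q zero    = [] ∷ []
box q (suc k) = cartesianProductWith _∷_ (allFin q) (box q k)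

box-unique : ∀ q k → Unique (box q k)
box-unique q zero    = [] ∷ []
box-unique q (suc k) =
  Unique.cartesianProductWith⁺ _∷_ ∷-injective (Unique.allFin⁺ q) (box-unique q k)

length-box : ∀ q k → length (box q k) ≡ q ^ k
length-box q zero    = refl
length-box q (suc k) = trans (length-cartesianProductWith _∷_ (allFin q) (box q k))
  (cong₂ _*_ (length-tabulate {n = q} (λ i → i)) (length-box q k))

digits : ∀ {q} → Vec (Fin q) k → Vec ℕ k
digits = Vec.map toℕ

digits-injective : ∀ {q} {u v : Vec (Fin q) k} → digits u ≡ digits v → u ≡ v
digits-injective {u = []}    {[]}    _  = refl
digits-injective {u = _ ∷ _} {_ ∷ _} eq =
  cong₂ _∷_ (toℕ-injective (proj₁ (∷-injective eq))) (digits-injective (proj₂ (∷-injective eq)))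

digits-≤ : ∀ {p} (u : Vec (Fin (suc p)) k) → All (_≤ p) (digits u)
digits-≤ u = map⁺ (All.universal toℕ≤pred[n] u)

All-⊕ : ∀ {p r} {u v : Vec ℕ k} → All (_≤ p) u → All (_≤ r) v → All (_≤ p + r) (u ⊕ v)
All-⊕ []        []        = []
All-⊕ (a≤ ∷ u≤) (b≤ ∷ v≤) = +-mono-≤ a≤ b≤ ∷ All-⊕ u≤ v≤

-- The skew corner-free set

-- One more than the largest sum of two digits from {0,...,p}.
base : ℕ → ℕ
base p = suc (p + p)

-- The largest code with all digits `p`, under a top digit that bounds both u·u and 2(u·w); `suc`
-- shifts to coordinates starting at 1.
side : ℕ → ℕ → ℕ
side k p = suc (encode (base p) (2 * (k * (p * p))) (replicate k p))

module Construction (k p : ℕ) where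

  abscissa : Vec (Fin (suc p)) k → ℕ
  abscissa u = encode (base p) (digits u · digits u) (digits u)

  ordinate : Vec (Fin (suc p)) k → Vec (Fin (suc p)) k → ℕ
  ordinate u w = encode (base p) (2 * (digits u · digits w)) (digits w)

  point : Vec (Fin (suc p)) k × Vec (Fin (suc p)) k → ℤ × ℤ
  point (u , w) = + suc (abscissa u) , + suc (ordinate u w)

  digits-<base : (u : Vec (Fin (suc p)) k) → All (_< base p) (digits u)
  digits-<base u = All.map (λ a≤p → s≤s (≤-trans a≤p (m≤m+n p p))) (digits-≤ u)

  encode-digits-injective : ∀ {s t} u v →
    encode (base p) s (digits u) ≡ encode (base p) t (digits v) → u ≡ v
  encode-digits-injective u v eq =
    digits-injective (proj₂ (encode-injective (base p) (digits-<base u) (digits-<base v) eq))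

  point-injective : ∀ {a b} → point a ≡ point b → a ≡ b
  point-injective {u , w} {u′ , w′} eq = cong₂ _,_
    (encode-digits-injective u u′ (suc-injective (ℤ.+-injective (cong proj₁ eq))))
    (encode-digits-injective w w′ (suc-injective (ℤ.+-injective (cong proj₂ eq))))

  points : FiniteSet (ℤ × ℤ)
  points = finiteSet (List.map point (cartesianProduct (box (suc p) k) (box (suc p) k)))
    (Unique.map⁺ point-injective
      (Unique.cartesianProduct⁺ (box-unique (suc p) k) (box-unique (suc p) k)))

  card-points : card points ≡ suc p ^ k * suc p ^ k
  card-points = trans (length-map point (cartesianProduct (box (suc p) k) (box (suc p) k)))
    (trans (length-cartesianProductWith _,_ (box (suc p) k) (box (suc p) k))
      (cong₂ _*_ (length-box (suc p) k) (length-box (suc p) k)))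

  points-⊆ : ∀ {n} → side k p ≤ n → points ⊆[ n ]²
  points-⊆ side≤n x y xy∈ with ∈-map⁻ point xy∈
  ... | (u , w) , _ , refl =
      inInterval (s≤s (encode-mono-≤ (base p) (digits-≤ u)
        -- The top digit of an abscissa is at most half of the one allowed in `side`.
        (≤-trans (·-≤ (digits-≤ u) (digits-≤ u)) (m≤m+n _ _))))
    , inInterval (s≤s (encode-mono-≤ (base p) (digits-≤ w)
        (*-monoʳ-≤ 2 (·-≤ (digits-≤ u) (digits-≤ w)))))
    where
    inInterval : ∀ {m} → m < side k p → InInterval _ (+ suc m)
    inInterval m< = ℤ.+≤+ (s≤s z≤n) , ℤ.+≤+ (≤-trans m< side≤n)

  corner-degenerate : ∀ u w₂ w u′ →
    abscissa u + ordinate u w₂ ≡ ordinate u w + abscissa u′ → u ≡ u′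
  corner-degenerate u w₂ w u′ eq = digits-injective
    (tangent-unique (digits u) (digits w₂) (digits w) (digits u′) (proj₂ eqs) (proj₁ eqs))
    where
    -- Digit sums are at most `p + p`, so both sides of `eq` can be compared digit by digit.
    sum-<base : ∀ a b → All (_< base p) (digits a ⊕ digits b)
    sum-<base a b = All.map s≤s (All-⊕ (digits-≤ a) (digits-≤ b))
    eqs = encode-injective (base p) (sum-<base u w₂) (sum-<base w u′)
      (trans (sym (encode-⊕ (base p) _ _ (digits u) (digits w₂)))
        (trans eq (encode-⊕ (base p) _ _ (digits w) (digits u′))))

  points-skewCornerFree : SkewCornerFree points
  points-skewCornerFree x y y′ d d≢0 (xy∈ , xy₂∈ , x′y′∈)
    with (u , w) , _ , xy≡ ← ∈-map⁻ point xy∈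
       | (v , w₂) , _ , xy₂≡ ← ∈-map⁻ point xy₂∈
       | (u′ , w′) , _ , x′y′≡ ← ∈-map⁻ point x′y′∈
    -- The first two points share their first coordinate, hence their vector `u`.
    with refl ← encode-digits-injective v u (suc-injective (ℤ.+-injective
           (trans (sym (cong proj₁ xy₂≡)) (cong proj₁ xy≡))))
    = d≢0 (identityʳ-unique x d (begin
        x ℤ.+ d             ≡⟨ cong proj₁ x′y′≡ ⟩
        + suc (abscissa u′) ≡⟨ cong (λ a → + suc (abscissa a)) (corner-degenerate u w₂ w u′ sums) ⟨
        + suc (abscissa u)  ≡⟨ cong proj₁ xy≡ ⟨
        x                   ∎))
    where
    open ≡-Reasoning
    -- This is x + (y + d) = y + (x + d), which eliminates `d`; the 2 cancelled collects the two
    -- shifts by `suc`.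
    sums : abscissa u + ordinate u w₂ ≡ ordinate u w + abscissa u′
    sums = +-cancelˡ-≡ 2 _ _ (begin
      2 + (abscissa u + ordinate u w₂)        ≡⟨ cong suc (+-suc (abscissa u) _) ⟨
      suc (abscissa u) + suc (ordinate u w₂)  ≡⟨ ℤ.+-injective sumsℤ ⟩
      suc (ordinate u w) + suc (abscissa u′)  ≡⟨ cong suc (+-suc (ordinate u w) _) ⟩
      2 + (ordinate u w + abscissa u′)        ∎)
      where
      sumsℤ : + suc (abscissa u) ℤ.+ + suc (ordinate u w₂)
            ≡ + suc (ordinate u w) ℤ.+ + suc (abscissa u′)
      sumsℤ = begin
        + suc (abscissa u) ℤ.+ + suc (ordinate u w₂)
          ≡⟨ cong₂ ℤ._+_ (cong proj₁ xy≡) (cong proj₂ xy₂≡) ⟨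
        x ℤ.+ (y ℤ.+ d)    ≡⟨ ℤ.+-assoc x y d ⟨
        x ℤ.+ y ℤ.+ d      ≡⟨ cong (ℤ._+ d) (ℤ.+-comm x y) ⟩
        y ℤ.+ x ℤ.+ d      ≡⟨ ℤ.+-assoc y x d ⟩
        y ℤ.+ (x ℤ.+ d)    ≡⟨ cong₂ ℤ._+_ (cong proj₂ xy≡) (cong proj₁ x′y′≡) ⟩
        + suc (ordinate u w) ℤ.+ + suc (abscissa u′) ∎

-- Choice of the parameter

-- Induction on `n`: keep `p` while `g p` still reaches `n`. Once it does not, `f (suc p) ≤ g p`
-- makes `suc p` admissible, and strict growth of `g` covers the increment of `n`.
interpolate : (f g : ℕ → ℕ) → f 0 ≤ 1 → 1 ≤ g 0 →
  (∀ p → f (suc p) ≤ g p) → (∀ p → g p < g (suc p)) →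
  ∀ n .{{_ : NonZero n}} → ∃[ p ] (f p ≤ n × n ≤ g p)
interpolate f g f0 g0 f≤g g< (suc zero) = 0 , f0 , g0
interpolate f g f0 g0 f≤g g< (suc (suc n))
  with p , fp≤ , ≤gp ← interpolate f g f0 g0 f≤g g< (suc n)
  with ≤-total (suc (suc n)) (g p)
... | inj₁ n≤gp = p , m≤n⇒m≤1+n fp≤ , n≤gp
... | inj₂ gp≤n = suc p , ≤-trans (f≤g p) gp≤n , ≤-trans (s≤s ≤gp) (g< p)

-- Each digit multiplies the bound by 4q: the base contributes 3q, and the digit `q` itself is
-- absorbed by one more `q * y`, since `y` is at least 1.
encode-replicate-≤ : ∀ k {B q t} .{{_ : NonZero q}} .{{_ : NonZero t}} → B ≤ 3 * q →
  encode B t (replicate k q) ≤ (4 * q) ^ k * t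
encode-replicate-≤ zero    {t = t} B≤3q = ≤-reflexive (sym (*-identityˡ t))
encode-replicate-≤ (suc k) {B} {q} {t} B≤3q = begin
  q + encode B t (replicate k q) * B
    ≤⟨ +-mono-≤ (m≤m*n q y) (*-mono-≤ (encode-replicate-≤ k B≤3q) B≤3q) ⟩
  q * y + y * (3 * q)                 ≡⟨ ring q y ⟩
  4 * q * y                           ≡⟨ *-assoc (4 * q) ((4 * q) ^ k) t ⟨
  (4 * q) ^ suc k * t                 ∎
  where
  open ≤-Reasoning
  y = (4 * q) ^ k * t
  instance
    y≢0 : NonZero y
    y≢0 = m*n≢0 _ t {{m^n≢0 (4 * q) k {{m*n≢0 4 q}}}}
  ring : ∀ q y → q * y + y * (3 * q) ≡ 4 * q * y
  ring = solve-∀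

-- With top digit 8q² the code is at most (4q)⁴ · 8q² = 2048q⁶; doubling this absorbs the final
-- `suc`.
side-suc-≤ : ∀ p → side 4 (suc p) ≤ 4096 * suc p ^ 6
side-suc-≤ p = begin
  1 + encode (base q) t (replicate 4 q)     ≤⟨ +-mono-≤ (>-nonZero⁻¹ (2048 * q ^ 6)) bound ⟩
  2048 * q ^ 6 + 2048 * q ^ 6               ≡⟨ *-distribʳ-+ (q ^ 6) 2048 2048 ⟨
  4096 * q ^ 6                              ∎
  where
  open ≤-Reasoning
  q = suc p
  t = 2 * (4 * (q * q))
  instance
    2048q⁶≢0 : NonZero (2048 * q ^ 6)
    2048q⁶≢0 = m*n≢0 2048 (q ^ 6) {{_}} {{m^n≢0 q 6}}
  base≤3q : base q ≤ 3 * q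
  base≤3q = +-mono-≤ (s≤s (z≤n {p})) (≤-reflexive (cong (λ r → q + r) (sym (+-identityʳ q))))
  ring : ∀ q → (4 * q) * ((4 * q) * ((4 * q) * ((4 * q) * 1))) * (2 * (4 * (q * q)))
             ≡ 2048 * (q * (q * (q * (q * (q * (q * 1))))))
  ring = solve-∀
  bound : encode (base q) t (replicate 4 q) ≤ 2048 * q ^ 6
  bound = ≤-trans (encode-replicate-≤ 4 base≤3q) (≤-reflexive (ring q))

parameter : ∀ n .{{_ : NonZero n}} → ∃[ p ] (side 4 p ≤ n × n ≤ 4096 * suc p ^ 6)
parameter = interpolate (side 4) (λ p → 4096 * suc p ^ 6) (s≤s z≤n) (s≤s z≤n)
  side-suc-≤ (λ p → *-monoʳ-< 4096 (^-monoˡ-< 6 (n<1+n (suc p))))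

^-distribʳ-* : ∀ a b e → (a * b) ^ e ≡ a ^ e * b ^ e
^-distribʳ-* a b zero    = refl
^-distribʳ-* a b (suc e) = trans (cong (a * b *_) (^-distribʳ-* a b e))
  ([m*n]*[o*p]≡[m*o]*[n*p] a b (a ^ e) (b ^ e))

^5≤^4 : ∀ n q .{{_ : NonZero q}} → n ≤ 4096 * q ^ 6 → n ^ 5 ≤ (32768 * (q ^ 4 * q ^ 4)) ^ 4
^5≤^4 n q n≤ = begin
  n ^ 5                            ≤⟨ ^-monoˡ-≤ 5 n≤ ⟩
  (4096 * q ^ 6) ^ 5               ≡⟨ ^-distribʳ-* 4096 (q ^ 6) 5 ⟩
  4096 ^ 5 * (q ^ 6) ^ 5           ≡⟨ cong (4096 ^ 5 *_) (^-*-assoc q 6 5) ⟩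
  4096 ^ 5 * q ^ 30
    -- Both constants equal 2⁶⁰, and the loss is only from q³⁰ to q³². The Boolean test decides the
    -- comparison without a unary proof term.
    ≤⟨ *-mono-≤ (≤ᵇ⇒≤ (4096 ^ 5) (32768 ^ 4) _) (^-monoʳ-≤ q (m≤m+n 30 2)) ⟩
  32768 ^ 4 * q ^ 32                ≡⟨ cong (32768 ^ 4 *_) (^-*-assoc q 8 4) ⟨
  32768 ^ 4 * (q ^ 8) ^ 4           ≡⟨ ^-distribʳ-* 32768 (q ^ 8) 4 ⟨
  (32768 * q ^ 8) ^ 4               ≡⟨ cong (λ m → (32768 * m) ^ 4) (^-distribˡ-+-* q 4 4) ⟩
  (32768 * (q ^ 4 * q ^ 4)) ^ 4     ∎
  where open ≤-Reasoning

-- Natural numbers as rationals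

-- Division in ℚ normalises by a gcd, so facts about `fromℕ` are transferred from unnormalised
-- fractions with denominator visibly 1.
toℚᵘ-fromℕ : ∀ n → ℚ.toℚᵘ (fromℕ n) ℚᵘ.≃ mkℚᵘ (+ n) 0
toℚᵘ-fromℕ n = ℚ.toℚᵘ-fromℚᵘ (mkℚᵘ (+ n) 0)

fromℕ-mono-≤ : ∀ {m n} → m ≤ n → fromℕ m ℚ.≤ fromℕ n
fromℕ-mono-≤ {m} {n} m≤n = ℚ.toℚᵘ-cancel-≤ (begin
  ℚ.toℚᵘ (fromℕ m)  ≃⟨ toℚᵘ-fromℕ m ⟩
  mkℚᵘ (+ m) 0      ≤⟨ *≤* (ℤ.*-monoʳ-≤-nonNeg 1ℤ (ℤ.+≤+ m≤n)) ⟩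
  mkℚᵘ (+ n) 0      ≃⟨ toℚᵘ-fromℕ n ⟨
  ℚ.toℚᵘ (fromℕ n)  ∎)
  where open ℚᵘ.≤-Reasoning

fromℕ-* : ∀ m n → fromℕ (m * n) ≡ fromℕ m ℚ.* fromℕ n
fromℕ-* m n = ℚ.toℚᵘ-injective (begin-equality
  ℚ.toℚᵘ (fromℕ (m * n))                    ≃⟨ toℚᵘ-fromℕ (m * n) ⟩
  mkℚᵘ (+ (m * n)) 0                        ≃⟨ *≡* (cong (ℤ._* 1ℤ) (ℤ.pos-* m n)) ⟩
  mkℚᵘ (+ m) 0 ℚᵘ.* mkℚᵘ (+ n) 0            ≃⟨ ℚᵘ.*-cong (toℚᵘ-fromℕ m) (toℚᵘ-fromℕ n) ⟨
  ℚ.toℚᵘ (fromℕ m) ℚᵘ.* ℚ.toℚᵘ (fromℕ n)    ≃⟨ ℚ.toℚᵘ-homo-* (fromℕ m) (fromℕ n) ⟨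
  ℚ.toℚᵘ (fromℕ m ℚ.* fromℕ n)              ∎)
  where open ℚᵘ.≤-Reasoning

fromℕ-^ : ∀ m e → fromℕ (m ^ e) ≡ fromℕ m ^ℚ e
fromℕ-^ m zero    = refl
fromℕ-^ m (suc e) = trans (fromℕ-* m (m ^ e)) (cong (fromℕ m ℚ.*_) (fromℕ-^ m e))

unitFraction-* : ∀ K .{{_ : NonZero K}} → 1ℤ ℚ./ K ℚ.* fromℕ K ≡ 1ℚ
unitFraction-* K@(suc K-1) = ℚ.toℚᵘ-injective (begin-equality
  ℚ.toℚᵘ (1ℤ ℚ./ K ℚ.* fromℕ K)             ≃⟨ ℚ.toℚᵘ-homo-* (1ℤ ℚ./ K) (fromℕ K) ⟩
  ℚ.toℚᵘ (1ℤ ℚ./ K) ℚᵘ.* ℚ.toℚᵘ (fromℕ K)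
    ≃⟨ ℚᵘ.*-cong (ℚ.toℚᵘ-fromℚᵘ (mkℚᵘ 1ℤ K-1)) (toℚᵘ-fromℕ K) ⟩
  mkℚᵘ 1ℤ K-1 ℚᵘ.* mkℚᵘ (+ K) 0             ≃⟨ *≡* (cong +_ (ring K-1)) ⟩
  ℚ.toℚᵘ 1ℚ                                 ∎)
  where
  open ℚᵘ.≤-Reasoning
  ring : ∀ k → (suc k + 0) * 1 ≡ suc k * 1 + 0
  ring = solve-∀

-- Multiplying the hypothesis by c⁴ with c = 1/K turns (K m)⁴ into m⁴.
^5≤^4⇒^5/4≤ : ∀ K .{{_ : NonZero K}} n m → n ^ 5 ≤ (K * m) ^ 4 → (1ℤ ℚ./ K) · n ^5/4≤ m
^5≤^4⇒^5/4≤ K n m n^5≤ = begin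
  c ^ℚ 4 ℚ.* fromℕ n ^ℚ 5          ≡⟨ cong (c ^ℚ 4 ℚ.*_) (fromℕ-^ n 5) ⟨
  c ^ℚ 4 ℚ.* fromℕ (n ^ 5)         ≤⟨ ℚ.*-monoˡ-≤-nonNeg (c ^ℚ 4) (fromℕ-mono-≤ n^5≤) ⟩
  c ^ℚ 4 ℚ.* fromℕ ((K * m) ^ 4)   ≡⟨ cong (c ^ℚ 4 ℚ.*_) (fromℕ-^ (K * m) 4) ⟩
  c ^ℚ 4 ℚ.* fromℕ (K * m) ^ℚ 4    ≡⟨ Exp.^-distrib-* ℚ-commutativeSemiring c (fromℕ (K * m)) 4 ⟨
  (c ℚ.* fromℕ (K * m)) ^ℚ 4       ≡⟨ cong (_^ℚ 4) cancel ⟩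
  fromℕ m ^ℚ 4                     ∎
  where
  open ℚ.≤-Reasoning
  ℚ-commutativeSemiring = CommutativeRing.commutativeSemiring ℚ.+-*-commutativeRing
  c = 1ℤ ℚ./ K
  c-nonNeg : ∀ e → ℚ.NonNegative (c ^ℚ e)
  c-nonNeg zero    = _
  c-nonNeg (suc e) = ℚ.nonNeg*nonNeg⇒nonNeg c {{ℚ.normalize-nonNeg 1 K}} (c ^ℚ e) {{c-nonNeg e}}
  instance
    c⁴-nonNeg : ℚ.NonNegative (c ^ℚ 4)
    c⁴-nonNeg = c-nonNeg 4
  cancel : c ℚ.* fromℕ (K * m) ≡ fromℕ m
  cancel = begin-equality
    c ℚ.* fromℕ (K * m)          ≡⟨ cong (c ℚ.*_) (fromℕ-* K m) ⟩
    c ℚ.* (fromℕ K ℚ.* fromℕ m)  ≡⟨ ℚ.*-assoc c (fromℕ K) (fromℕ m) ⟨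
    c ℚ.* fromℕ K ℚ.* fromℕ m    ≡⟨ cong (ℚ._* fromℕ m) (unitFraction-* K) ⟩
    1ℚ ℚ.* fromℕ m               ≡⟨ ℚ.*-identityˡ (fromℕ m) ⟩
    fromℕ m                      ∎

theorem1p1 : Σ[ c ∈ ℚ ] (0ℚ ℚ.< c × (∀ (n : ℕ) .{{_ : NonZero n}} →
    Σ[ S ∈ FiniteSet (ℤ × ℤ) ] (S ⊆[ n ]² × c · n ^5/4≤ card S × SkewCornerFree S)))
theorem1p1 = c , ℚ.positive⁻¹ c {{ℚ.normalize-pos 1 32768}} , λ n → construct n (parameter n)
  where
  -- 32768 = 2¹⁵ is the 5/4 power of the side constant 4096 = 2¹².
  c = 1ℤ ℚ./ 32768
  -- Not a with-abstraction: that would normalise 4096 * _ to 4096 summands.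
  construct : ∀ n → ∃[ p ] (side 4 p ≤ n × n ≤ 4096 * suc p ^ 6) →
    Σ[ S ∈ FiniteSet (ℤ × ℤ) ] (S ⊆[ n ]² × c · n ^5/4≤ card S × SkewCornerFree S)
  construct n (p , side≤n , n≤) = points , points-⊆ side≤n
    , subst (c · n ^5/4≤_) (sym card-points)
        (^5≤^4⇒^5/4≤ 32768 n (suc p ^ 4 * suc p ^ 4) (^5≤^4 n (suc p) n≤))
    , points-skewCornerFree
    where open Construction 4 p
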